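{- Suppose $\mathbb K$ is a computable age with the hereditary property (HP). Then $\mathbb K$ has the $\mathscr{EI}(\mathbb K)$-computable hereditary property; that is, there is a function, computable from the embedding information $\mathscr{EI}(\mathbb K)$, that takes each pair $(\mathbb I(i),\mathbf b)$ with $\mathbf b\in\mathcal A_i$ a finite tuple and returns some $\mathbb I(j)$ such that $\mathbf a_j\simeq\mathbf b$.
   Context: Languages and structures. $\mathcal{L}$ is a countable language (relation symbols of positive arity; function symbols of any arity, 0-ary ones being constants) with a computable representation: relation symbols $R_n$ and function symbols $F_m$ are indexed bijectively by disjoint computable subsets of $\omega$, with arity computable from the index. An $\mathcal{L}$-structure $\mathcal{M}$ is c.e. if its underlying set $M$ is a c.e. subset of $\omega$ and the sets $\{(n,\mathbf a): \mathcal M\models R_n(\mathbf a)\}$, $\{(n,\mathbf a): \mathcal M\models \neg R_n(\mathbf a)\}$, $\{(m,\mathbf a,b): \mathcal M\models F_m(\mathbf a)=b\}$ are c.e.; it is computable if moreover $M$ is computable. Tuples are finite; $\mathrm{cl}_{\mathcal M}(\mathbf a)$ is the smallest substructure of $\mathcal M$ containing $\mathbf a$. For $\mathbf a\in\mathcal A$, $\mathbf b\in\mathcal B$ of the same length, $\mathbf a\simeq\mathbf b$ means that for every atomic $\mathcal L$-formula $\varphi$, $\mathcal A\models\varphi(\mathbf a)$ iff $\mathcal B\models\varphi(\mathbf b)$; equivalently $\mathbf a\mapsto\mathbf b$ extends to an isomorphism $\mathrm{cl}(\mathbf a)\to\mathrm{cl}(\mathbf b)$. Ages. An age is a collection of finitely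 generated $\mathcal L$-structures closed under isomorphism. A computable age (computable representation of an age $\mathcal K$) is a c.e. set $\mathbb K$ of triples $(\mathbf a,\mathcal A,i)$ (computable structures being given by indices), with exactly one triple for each $i\in\omega$, written $\mathbb I(i)=(\mathbf a_i,\mathcal A_i,i)$, such that each $\mathcal A_i$ is a computable $\mathcal L$-structure in $\mathcal K$ with $\mathcal A_i=\mathrm{cl}_{\mathcal A_i}(\mathbf a_i)$, and every $\mathcal B\in\mathcal K$ is isomorphic to some $\mathcal A_i$. $\mathbb K$ is said to have a property of ages if $\mathcal K$ does. The embedding information $\mathscr{EI}(\mathbb K)$ is the set of tuples $(\mathbb I(k_0),\mathbf b_0,\mathbb I(k_1),\mathbf b_1)$ with $\mathbf b_0\in\mathcal A_{k_0}$, $\mathbf b_1\in\mathcal A_{k_1}$ and $\mathbf b_0\simeq\mathbf b_1$. (HP): for all $\mathcal B\in\mathcal K$, $\mathcal A\subseteq\mathcal B$ implies $\mathcal A\in\mathcal K$.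
   Formalization: Completeness of a computable age is strengthened: every B in K with any tuple b generating it is isomorphic to some A_i by a map taking a_i to b. With only B isomorphic to A_i the claim fails (sets of size at most 1, all a_i of length at most 1, b=(0,0)). -}

module Defs where

open import Level using (Level; 0ℓ; _⊔_) renaming (suc to lsuc)
open import Data.Bool.Base using (Bool; T)
open import Data.Nat.Base using (ℕ; zero; suc; _+_; _<_)
open import Data.Fin.Base using (Fin; toℕ; cast)
open import Data.List.Base as List using (List; []; _∷_; length)
open import Data.List.Relation.Binary.Pointwise using (Pointwise)
open import Data.Vec.Base as Vec using (Vec; []; _∷_)
open import Data.Vec.Functional using (Vector; toList)
open import Data.Product.Base using (Σ; ∃; ∃-syntax; _×_; _,_; proj₁; proj₂)
open import Function.Base using (_∘_)
open import Function.Bundles using (_⇔_; Inverse)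
open import Relation.Binary.Bundles using (Setoid)
open import Relation.Binary.PropositionalEquality using (_≡_; setoid)
import Relation.Binary.Construct.On as On
open import Relation.Nullary.Negation.Core using (¬_)
open import Relation.Unary using (Pred)

------------------------------------------------------------------------
-- Coding of pairs and finite sequences of natural numbers

triangle : ℕ → ℕ
triangle zero    = zero
triangle (suc n) = suc n + triangle n

-- The Cantor pairing bijection.
⟨_,_⟩ : ℕ → ℕ → ℕ
⟨ x , y ⟩ = triangle (x + y) + y

⌜_⌝ : List ℕ → ℕ
⌜ [] ⌝     = 0
⌜ x ∷ xs ⌝ = suc ⟨ x , ⌜ xs ⌝ ⟩

------------------------------------------------------------------------
-- Oracle computability

-- Programs for the n-ary partial recursive functions with one oracle.
data Code : ℕ → Set where
  zeroᶜ  : ∀ {n} → Code n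
  sucᶜ   : Code 1
  proj   : ∀ {n} → Fin n → Code n
  oracle : Code 1
  comp   : ∀ {m n} → Code m → Vec (Code n) m → Code n
  prec   : ∀ {n} → Code n → Code (suc (suc n)) → Code (suc n)
  mu     : ∀ {n} → Code (suc n) → Code n

-- X ⊢ c [ xs ]⇓ y : the program c with oracle X halts on input xs with
-- output y.  The oracle answers 1 for membership and 0 otherwise.
data _⊢_[_]⇓_ (X : Pred ℕ 0ℓ) : ∀ {n} → Code n → Vec ℕ n → ℕ → Set where
  zero⇓ : ∀ {n} {xs : Vec ℕ n} → X ⊢ zeroᶜ [ xs ]⇓ 0
  suc⇓  : ∀ {x} → X ⊢ sucᶜ [ x ∷ [] ]⇓ suc x
  proj⇓ : ∀ {n} {xs : Vec ℕ n} (i : Fin n) →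
          X ⊢ proj i [ xs ]⇓ Vec.lookup xs i
  yes⇓  : ∀ {x} → X x → X ⊢ oracle [ x ∷ [] ]⇓ 1
  no⇓   : ∀ {x} → ¬ X x → X ⊢ oracle [ x ∷ [] ]⇓ 0
  comp⇓ : ∀ {m n} {f : Code m} {gs : Vec (Code n) m} {xs ys y} →
          (∀ i → X ⊢ Vec.lookup gs i [ xs ]⇓ Vec.lookup ys i) →
          X ⊢ f [ ys ]⇓ y → X ⊢ comp f gs [ xs ]⇓ y
  base⇓ : ∀ {n} {f : Code n} {g xs y} →
          X ⊢ f [ xs ]⇓ y → X ⊢ prec f g [ 0 ∷ xs ]⇓ y
  step⇓ : ∀ {n} {f : Code n} {g xs k r y} →
          X ⊢ prec f g [ k ∷ xs ]⇓ r → X ⊢ g [ k ∷ r ∷ xs ]⇓ y →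
          X ⊢ prec f g [ suc k ∷ xs ]⇓ y
  mu⇓   : ∀ {n} {f : Code (suc n)} {xs y} →
          X ⊢ f [ y ∷ xs ]⇓ 0 →
          (∀ z → z < y → ∃[ w ] X ⊢ f [ z ∷ xs ]⇓ suc w) →
          X ⊢ mu f [ xs ]⇓ y

data ∅ : Pred ℕ 0ℓ where

-- Unrelativized computation is computation with the empty oracle.
_[_]⇓_ : ∀ {n} → Code n → Vec ℕ n → ℕ → Set
c [ xs ]⇓ y = ∅ ⊢ c [ xs ]⇓ y

mutual
  gödel : ∀ {n} → Code n → ℕ
  gödel zeroᶜ       = ⟨ 0 , 0 ⟩
  gödel sucᶜ        = ⟨ 1 , 0 ⟩
  gödel (proj i)    = ⟨ 2 , toℕ i ⟩
  gödel oracle      = ⟨ 3 , 0 ⟩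
  gödel (comp f gs) = ⟨ 4 , ⟨ gödel f , ⌜ gödels gs ⌝ ⟩ ⟩
  gödel (prec f g)  = ⟨ 5 , ⟨ gödel f , gödel g ⟩ ⟩
  gödel (mu f)      = ⟨ 6 , gödel f ⟩

  gödels : ∀ {m n} → Vec (Code n) m → List ℕ
  gödels []       = []
  gödels (g ∷ gs) = gödel g ∷ gödels gs

Decides : Code 1 → Pred ℕ 0ℓ → Set
Decides c S = ∀ x → (S x → c [ x ∷ [] ]⇓ 1) × (¬ S x → c [ x ∷ [] ]⇓ 0)

-- c computes a total function listing S: value suc x at stage s means that x
-- is listed at s, value 0 that nothing is.  Allowing empty stages makes the
-- empty set c.e. without a separate clause.
record Enumerates (c : Code 1) (S : Pred ℕ 0ℓ) : Set where
  field
    total : ∀ s → ∃[ y ] c [ s ∷ [] ]⇓ y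
    lists : ∀ x → S x ⇔ (∃[ s ] c [ s ∷ [] ]⇓ suc x)

IsComputableSet : Pred ℕ 0ℓ → Set
IsComputableSet S = ∃[ c ] Decides c S

IsCE : Pred ℕ 0ℓ → Set
IsCE S = ∃[ c ] Enumerates c S

------------------------------------------------------------------------
-- Languages and structures

-- Symbols are identified with their indices.  The index sets are Bool-valued
-- so that an index carries at most one symbol of each kind.
record Language : Set where
  field
    isRel isFun : ℕ → Bool

  RelSym : Set
  RelSym = ∃ (T ∘ isRel)

  FunSym : Set
  FunSym = ∃ (T ∘ isFun)

  field
    relArity           : RelSym → ℕ
    funArity           : FunSym → ℕ
    relArity-positive  : ∀ R → 0 < relArity R
    disjoint           : ∀ n → T (isRel n) → ¬ T (isFun n)
    isRel-computable   : IsComputableSet (T ∘ isRel)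
    isFun-computable   : IsComputableSet (T ∘ isFun)
    relArity-computable : ∃[ c ] (∀ R → c [ proj₁ R ∷ [] ]⇓ relArity R)
    funArity-computable : ∃[ c ] (∀ F → c [ proj₁ F ∷ [] ]⇓ funArity F)

module _ (L : Language) where
  open Language L

  record Interpretation (S : Setoid 0ℓ 0ℓ) : Set₁ where
    open Setoid S
    field
      rel      : (R : RelSym) → Pred (Vector Carrier (relArity R)) 0ℓ
      fun      : (F : FunSym) → Vector Carrier (funArity F) → Carrier
      rel-resp : ∀ R {xs ys} → (∀ k → xs k ≈ ys k) → rel R xs → rel R ys
      fun-cong : ∀ F {xs ys} → (∀ k → xs k ≈ ys k) → fun F xs ≈ fun F ys

  -- Structures have setoid carriers, ≈ being the equality of the structure.
  -- The carrier may be empty if L has no constants.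
  record Structure : Set₁ where
    field
      carrier        : Setoid 0ℓ 0ℓ
      interpretation : Interpretation carrier
    open Setoid carrier public
    open Interpretation interpretation public

  data Term (n : ℕ) : Set where
    var : Fin n → Term n
    app : (F : FunSym) → Vector (Term n) (funArity F) → Term n

  data Atomic (n : ℕ) : Set where
    equal  : Term n → Term n → Atomic n
    relate : (R : RelSym) → Vector (Term n) (relArity R) → Atomic n

module _ {L : Language} where
  open Language L

  ∣_∣ : Structure L → Set
  ∣ 𝒜 ∣ = Structure.Carrier 𝒜

  Tuple : Structure L → Set
  Tuple 𝒜 = List ∣ 𝒜 ∣

  module _ (𝒜 : Structure L) where
    open Structure 𝒜

    eval : ∀ {n} → Vector Carrier n → Term L n → Carrier
    eval ρ (var k)    = ρ k
    eval ρ (app F ts) = fun F (λ k → eval ρ (ts k))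

    _⊨_[_] : ∀ {n} → Atomic L n → Vector Carrier n → Set
    _⊨_[_] (equal s t)   ρ = eval ρ s ≈ eval ρ t
    _⊨_[_] (relate R ts) ρ = rel R (λ k → eval ρ (ts k))

    record IsSubstructure (P : Pred Carrier 0ℓ) : Set where
      field
        resp   : ∀ {x y} → x ≈ y → P x → P y
        closed : ∀ F xs → (∀ k → P (xs k)) → P (fun F xs)

    restrict : (P : Pred Carrier 0ℓ) → IsSubstructure P → Structure L
    restrict P sub = record
      { carrier        = On.setoid {B = ∃ P} carrier proj₁
      ; interpretation = record
        { rel      = λ R xs → rel R (proj₁ ∘ xs)
        ; fun      = λ F xs → fun F (proj₁ ∘ xs) ,
                              IsSubstructure.closed sub F (proj₁ ∘ xs) (proj₂ ∘ xs)
        ; rel-resp = λ R → rel-resp R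
        ; fun-cong = λ F → fun-cong F
        }
      }

    data Cl (as : List Carrier) : Pred Carrier 0ℓ where
      generator : ∀ k → Cl as (List.lookup as k)
      closed    : ∀ F xs → (∀ k → Cl as (xs k)) → Cl as (fun F xs)
      resp      : ∀ {x y} → x ≈ y → Cl as x → Cl as y

    Generates : List Carrier → Set
    Generates as = ∀ x → Cl as x

  record _≃_ {𝒜 ℬ : Structure L} (a : Tuple 𝒜) (b : Tuple ℬ) : Set where
    field
      same-length : length a ≡ length b
      same-atomic : ∀ (φ : Atomic L (length a)) →
                    _⊨_[_] 𝒜 φ (List.lookup a) ⇔
                    _⊨_[_] ℬ φ (List.lookup b ∘ cast same-length)

  record _≅_ (𝒜 ℬ : Structure L) : Set where
    private
      module A = Structure 𝒜
      module B = Structure ℬ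
    field
      bijection : Inverse A.carrier B.carrier
    open Inverse bijection public using (to; from)
    field
      rel-iso : ∀ R xs → A.rel R xs ⇔ B.rel R (to ∘ xs)
      fun-iso : ∀ F xs → to (A.fun F xs) B.≈ B.fun F (to ∘ xs)

------------------------------------------------------------------------
-- Structures on subsets of ω, and their computability

record ωStructure (L : Language) : Set₁ where
  field
    dom            : Pred ℕ 0ℓ
    interpretation : Interpretation L (On.setoid {B = ∃ dom} (setoid ℕ) proj₁)

  structure : Structure L
  structure = record { interpretation = interpretation }

module _ {L : Language} (ℳ : ωStructure L) where
  open Language L
  open ωStructure ℳ
  open Structure structure using (Carrier; rel; fun)

  codeTuple : List Carrier → ℕ
  codeTuple a = ⌜ List.map proj₁ a ⌝

  TrueFacts FalseFacts FunGraph : Pred ℕ 0ℓ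
  TrueFacts  x = ∃[ R ] ∃[ a ] rel R a × x ≡ ⟨ proj₁ R , codeTuple (toList a) ⟩
  FalseFacts x = ∃[ R ] ∃[ a ] ¬ rel R a × x ≡ ⟨ proj₁ R , codeTuple (toList a) ⟩
  FunGraph   x = ∃[ F ] ∃[ a ]
    x ≡ ⟨ proj₁ F , ⟨ codeTuple (toList a) , proj₁ (fun F a) ⟩ ⟩

  record CEPresentation : Set where
    field
      domᶜ relᶜ nrelᶜ funᶜ : Code 1
      dom-ce  : Enumerates domᶜ dom
      rel-ce  : Enumerates relᶜ TrueFacts
      nrel-ce : Enumerates nrelᶜ FalseFacts
      fun-ce  : Enumerates funᶜ FunGraph

  record ComputablePresentation : Set where
    field
      ce             : CEPresentation
      decideᶜ        : Code 1
      dom-computable : Decides decideᶜ dom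
    open CEPresentation ce public

    index : ℕ
    index = ⌜ gödel decideᶜ ∷ gödel domᶜ ∷ gödel relᶜ ∷ gödel nrelᶜ ∷ gödel funᶜ ∷ [] ⌝

-- e is an index of the computable structure ℳ.
_IsIndexOf_ : ∀ {L} → ℕ → ωStructure L → Set
e IsIndexOf ℳ = ∃[ p ] e ≡ ComputablePresentation.index {ℳ = ℳ} p

------------------------------------------------------------------------
-- Ages

module _ {L : Language} {ℓ : Level} where

  record IsAge (𝒦 : Pred (Structure L) ℓ) : Set (lsuc 0ℓ ⊔ ℓ) where
    field
      finitely-generated : ∀ {𝒜} → 𝒦 𝒜 → ∃[ a ] Generates 𝒜 a
      iso-closed         : ∀ {𝒜 ℬ} → 𝒜 ≅ ℬ → 𝒦 𝒜 → 𝒦 ℬ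

  HP : Pred (Structure L) ℓ → Set (lsuc 0ℓ ⊔ ℓ)
  HP 𝒦 = ∀ ℬ → 𝒦 ℬ → ∀ P (sub : IsSubstructure ℬ P) → 𝒦 (restrict ℬ P sub)

  record ComputableAge (𝒦 : Pred (Structure L) ℓ) : Set (lsuc 0ℓ ⊔ ℓ) where
    field
      𝒜 : ℕ → ωStructure L

    A : ℕ → Structure L
    A i = ωStructure.structure (𝒜 i)

    field
      a         : ∀ i → Tuple (A i)
      e         : ℕ → ℕ
      e-index   : ∀ i → e i IsIndexOf 𝒜 i
      in-age    : ∀ i → 𝒦 (A i)
      generated : ∀ i → Generates (A i) (a i)
      -- The members of the representation are structures with a distinguished
      -- generating tuple, and completeness is up to isomorphism of such: each
      -- ℬ in 𝒦, with any tuple b generating it, is isomorphic to some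
      -- (A i , a i).  Were b disregarded, a generating tuple could fail to be
      -- ≃-equivalent to any a j: if 𝒦 is the class of sets of size at most 1
      -- and all a i have length at most 1, so would be (x , x).
      represents : ∀ ℬ → 𝒦 ℬ → ∀ b → Generates ℬ b →
                   ∃[ i ] Σ (A i ≅ ℬ) λ f →
                     Pointwise (Structure._≈_ ℬ) (List.map (_≅_.to f) (a i)) b

    𝕀 : ℕ → ℕ
    𝕀 i = ⟨ codeTuple (𝒜 i) (a i) , ⟨ e i , i ⟩ ⟩

    -- The set of triples, which has exactly one member for each i.
    Triples : Pred ℕ 0ℓ
    Triples x = ∃[ i ] x ≡ 𝕀 i

    field
      triples-ce : IsCE Triples

    codePointed : ∀ i → Tuple (A i) → ℕ
    codePointed i b = ⟨ 𝕀 i , codeTuple (𝒜 i) b ⟩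

  module _ {𝒦 : Pred (Structure L) ℓ} (𝕂 : ComputableAge 𝒦) where
    open ComputableAge 𝕂

    EmbeddingInfo : Pred ℕ 0ℓ
    EmbeddingInfo x = ∃[ k₀ ] ∃[ k₁ ] Σ (Tuple (A k₀)) λ b₀ → Σ (Tuple (A k₁)) λ b₁ →
      x ≡ ⟨ codePointed k₀ b₀ , codePointed k₁ b₁ ⟩ × _≃_ {𝒜 = A k₀} {ℬ = A k₁} b₀ b₁

    ComputableHP : Pred ℕ 0ℓ → Set
    ComputableHP X = ∃[ c ] (∀ i (b : Tuple (A i)) → ∃[ j ]
      X ⊢ c [ codePointed i b ∷ [] ]⇓ 𝕀 j × _≃_ {𝒜 = A j} {ℬ = A i} (a j) b)

{-# OPTIONS --safe #-}

-- On input n the program returns the least x for which the oracle contains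
-- ⟨ ⟨ x , π₁ x ⟩ , n ⟩.  As π₁ (𝕀 j) is the code of a j, this is the
-- question whether x is some 𝕀 j with a j ≃ b when n is the code of (𝕀 i , b);
-- membership in the embedding information already forces x to be of the form
-- 𝕀 j, so the triples need not be enumerated.  The search succeeds since,
-- by HP, the substructure generated by b is in 𝒦, hence represented together
-- with its generating tuple b.

module Submission where

open import Defs
open import Level using (Level; 0ℓ)
open import Axiom.ExcludedMiddle using (ExcludedMiddle)
open import Data.Nat.Base
  using (ℕ; zero; suc; pred; _+_; _∸_; _≤_; _<_; z≤n; s≤s; s≤s⁻¹; >-nonZero)
open import Data.Nat.Properties
open import Data.Nat.Induction using (<-rec)
open import Data.Fin.Base using (Fin; cast) renaming (zero to 0F)
open import Data.Fin.Patterns using (1F)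
open import Data.Fin.Properties using (cast-is-id; cast-trans)
open import Data.List.Base as List using (List; []; _∷_; tabulate)
open import Data.List.Properties using (map-tabulate; tabulate-lookup; map-id)
open import Data.List.Membership.Propositional.Properties using (∈-tabulate⁺)
open import Data.List.Relation.Unary.Any using (index)
open import Data.List.Relation.Unary.Any.Properties using (lookup-index)
open import Data.List.Relation.Binary.Pointwise as Pointwise
  using (Pointwise; Pointwise-length)
open import Data.Product.Base using (∃; ∃₂; ∃-syntax; _×_; _,_; proj₁; proj₂)
open import Data.Vec.Base using ([]; _∷_)
open import Function.Base using (id; _∘_)
open import Function.Bundles using (_⇔_; mk⇔; Injection)
open import Function.Properties.Inverse using (Inverse⇒Injection)
open import Function.Construct.Composition using () renaming (_⇔-∘_ to infixr 8 _⇔∘_)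
open import Function.Properties.Equivalence using () renaming (refl to ⇔-refl; sym to ⇔-sym)
open import Relation.Binary.Definitions using (tri<; tri≈; tri>)
open import Relation.Binary.PropositionalEquality
  using (_≡_; refl; sym; trans; cong; subst; module ≡-Reasoning)
open import Relation.Nullary.Decidable using (yes; no)
open import Relation.Nullary.Negation using (¬_; contradiction)
open import Relation.Unary using (Pred; Decidable)

-- Pairing and unpairing

triangle-mono-≤ : ∀ {m n} → m ≤ n → triangle m ≤ triangle n
triangle-mono-≤ {zero}          _   = z≤n
triangle-mono-≤ {suc m} {suc n} m≤n = +-mono-≤ m≤n (triangle-mono-≤ (s≤s⁻¹ m≤n))

-- The pairs on the diagonal `x + y ≡ s` fill the interval from `triangle s` up to but excluding
-- `triangle (suc s)`, because `y ≤ s`. This upper bound separates the diagonals and lets a program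
-- find them.
pair<triangle : ∀ x y → ⟨ x , y ⟩ < triangle (suc (x + y))
pair<triangle x y = begin-strict
  triangle (x + y) + y         ≤⟨ +-monoʳ-≤ (triangle (x + y)) (m≤n+m y x) ⟩
  triangle (x + y) + (x + y)   ≡⟨ +-comm (triangle (x + y)) (x + y) ⟩
  x + y + triangle (x + y)     <⟨ n<1+n _ ⟩
  triangle (suc (x + y))       ∎
  where open ≤-Reasoning

pair-mono-< : ∀ x y x′ y′ → x + y < x′ + y′ → ⟨ x , y ⟩ < ⟨ x′ , y′ ⟩
pair-mono-< x y x′ y′ s<s′ = begin-strict
  ⟨ x , y ⟩              <⟨ pair<triangle x y ⟩
  triangle (suc (x + y)) ≤⟨ triangle-mono-≤ s<s′ ⟩
  triangle (x′ + y′)     ≤⟨ m≤m+n _ y′ ⟩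
  ⟨ x′ , y′ ⟩            ∎
  where open ≤-Reasoning

-- Codes on different diagonals lie in disjoint intervals; on a common diagonal the offset from its
-- start is `y`.
pair-injective : ∀ {x y x′ y′} → ⟨ x , y ⟩ ≡ ⟨ x′ , y′ ⟩ → x ≡ x′ × y ≡ y′
pair-injective {x} {y} {x′} {y′} eq with <-cmp (x + y) (x′ + y′)
... | tri< s<s′ _ _ = contradiction eq (<⇒≢ (pair-mono-< x y x′ y′ s<s′))
... | tri> _ _ s′<s = contradiction (sym eq) (<⇒≢ (pair-mono-< x′ y′ x y s′<s))
... | tri≈ _ s≡s′ _ = +-cancelʳ-≡ y x x′ (trans s≡s′ (cong (x′ +_) (sym y≡y′))) , y≡y′
  where
  y≡y′ : y ≡ y′
  y≡y′ = +-cancelˡ-≡ (triangle (x + y)) y y′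
           (trans eq (cong (λ s → triangle s + y′) (sym s≡s′)))

⌜⌝-injective : ∀ {xs ys} → ⌜ xs ⌝ ≡ ⌜ ys ⌝ → xs ≡ ys
⌜⌝-injective {[]}     {[]}     _  = refl
⌜⌝-injective {x ∷ xs} {y ∷ ys} eq with refl , eq′ ← pair-injective {x} {_} {y} (suc-injective eq) =
  cong (x ∷_) (⌜⌝-injective eq′)

-- The codes are traversed in order: a successor moves one place along the diagonal, and from its
-- end `(0 , y)` to the start `(suc y , 0)` of the next one.
unpair : ∀ z → ∃₂ λ x y → z ≡ ⟨ x , y ⟩
unpair zero    = 0 , 0 , refl
unpair (suc z) with unpair z
... | suc x , y , refl =
  x , suc y , trans (sym (+-suc _ y)) (cong (λ s → triangle s + suc y) (sym (+-suc x y)))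
... | zero  , y , refl = suc y , 0 ,
  (begin
    suc (triangle y + y)       ≡⟨ cong suc (+-comm (triangle y) y) ⟩
    triangle (suc y)           ≡⟨ cong triangle (+-identityʳ (suc y)) ⟨
    triangle (suc y + 0)       ≡⟨ +-identityʳ _ ⟨
    triangle (suc y + 0) + 0   ∎)
  where open ≡-Reasoning

π₁ : ℕ → ℕ
π₁ z = proj₁ (unpair z)

π₁-pair : ∀ x y → π₁ ⟨ x , y ⟩ ≡ x
π₁-pair x y = sym (proj₁ (pair-injective {x} {y} (proj₂ (proj₂ (unpair ⟨ x , y ⟩)))))

-- Arithmetic and search in the oracle model

module _ {X : Pred ℕ 0ℓ} where

  ⇓-resp : ∀ {n} {c : Code n} {xs y z} → y ≡ z → X ⊢ c [ xs ]⇓ y → X ⊢ c [ xs ]⇓ z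
  ⇓-resp refl c⇓ = c⇓

  comp₁⇓ : ∀ {n f} {g : Code n} {xs a y} →
           X ⊢ g [ xs ]⇓ a → X ⊢ f [ a ∷ [] ]⇓ y →
           X ⊢ comp f (g ∷ []) [ xs ]⇓ y
  comp₁⇓ g⇓ = comp⇓ λ { 0F → g⇓ }

  comp₂⇓ : ∀ {n f} {g h : Code n} {xs a b y} →
           X ⊢ g [ xs ]⇓ a → X ⊢ h [ xs ]⇓ b → X ⊢ f [ a ∷ b ∷ [] ]⇓ y →
           X ⊢ comp f (g ∷ h ∷ []) [ xs ]⇓ y
  comp₂⇓ g⇓ h⇓ = comp⇓ λ { 0F → g⇓ ; 1F → h⇓ }

plusᶜ : Code 2
plusᶜ = prec (proj 0F) (comp sucᶜ (proj 1F ∷ []))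

plus⇓ : ∀ {X} x y → X ⊢ plusᶜ [ x ∷ y ∷ [] ]⇓ (x + y)
plus⇓ zero    y = base⇓ (proj⇓ 0F)
plus⇓ (suc x) y = step⇓ (plus⇓ x y) (comp₁⇓ (proj⇓ 1F) suc⇓)

predᶜ : Code 1
predᶜ = prec zeroᶜ (proj 0F)

pred⇓ : ∀ {X} x → X ⊢ predᶜ [ x ∷ [] ]⇓ pred x
pred⇓ zero    = base⇓ zero⇓
pred⇓ (suc x) = step⇓ (pred⇓ x) (proj⇓ 0F)

-- The arguments are swapped, as the recursion is on the subtrahend.
monusᶜ : Code 2
monusᶜ = prec (proj 0F) (comp predᶜ (proj 1F ∷ []))

monus⇓ : ∀ {X} y x → X ⊢ monusᶜ [ y ∷ x ∷ [] ]⇓ (x ∸ y)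
monus⇓ zero    x = base⇓ (proj⇓ 0F)
monus⇓ (suc y) x = step⇓ (monus⇓ y x)
  (⇓-resp (pred[m∸n]≡m∸[1+n] x y) (comp₁⇓ (proj⇓ 1F) (pred⇓ (x ∸ y))))

-- Minimization looks for the value 0, whereas the oracle answers 1 for membership, so its answer
-- has to be inverted.
isZeroᶜ : Code 1
isZeroᶜ = prec (comp sucᶜ (zeroᶜ ∷ [])) zeroᶜ

isZero-0⇓ : ∀ {X} → X ⊢ isZeroᶜ [ 0 ∷ [] ]⇓ 1
isZero-0⇓ = base⇓ (comp₁⇓ zero⇓ suc⇓)

isZero-1⇓ : ∀ {X} → X ⊢ isZeroᶜ [ 1 ∷ [] ]⇓ 0
isZero-1⇓ = step⇓ isZero-0⇓ zero⇓

triangleᶜ : Code 1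
triangleᶜ = prec zeroᶜ (comp plusᶜ (comp sucᶜ (proj 0F ∷ []) ∷ proj 1F ∷ []))

triangle⇓ : ∀ {X} n → X ⊢ triangleᶜ [ n ∷ [] ]⇓ triangle n
triangle⇓ zero    = base⇓ zero⇓
triangle⇓ (suc n) = step⇓ (triangle⇓ n)
  (comp₂⇓ (comp₁⇓ (proj⇓ 0F) suc⇓) (proj⇓ 1F) (plus⇓ (suc n) (triangle n)))

pairᶜ : Code 2
pairᶜ = comp plusᶜ (comp triangleᶜ (plusᶜ ∷ []) ∷ proj 1F ∷ [])

pair⇓ : ∀ {X} x y → X ⊢ pairᶜ [ x ∷ y ∷ [] ]⇓ ⟨ x , y ⟩
pair⇓ x y = comp₂⇓ (comp₁⇓ (plus⇓ x y) (triangle⇓ (x + y))) (proj⇓ 1F)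
                   (plus⇓ (triangle (x + y)) y)

-- x + y is the least s with ⟨ x , y ⟩ < triangle (suc s).
diagonalᶜ : Code 1
diagonalᶜ = mu (comp monusᶜ (comp triangleᶜ (comp sucᶜ (proj 0F ∷ []) ∷ []) ∷
                             comp sucᶜ (proj 1F ∷ []) ∷ []))

diagonal⇓ : ∀ {X} x y → X ⊢ diagonalᶜ [ ⟨ x , y ⟩ ∷ [] ]⇓ (x + y)
diagonal⇓ {X} x y = mu⇓
  -- The difference `suc z ∸ t` vanishes exactly when `z < t`; the `suc` makes the comparison
  -- strict.
  (⇓-resp (m≤n⇒m∸n≡0 (pair<triangle x y)) (body⇓ (x + y)))
  (λ s s<x+y → pred (suc ⟨ x , y ⟩ ∸ triangle (suc s)) ,
    ⇓-resp (sym (positive s s<x+y)) (body⇓ s))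
  where
  body⇓ : ∀ s → X ⊢ _ [ s ∷ ⟨ x , y ⟩ ∷ [] ]⇓ (suc ⟨ x , y ⟩ ∸ triangle (suc s))
  body⇓ s = comp₂⇓ (comp₁⇓ (comp₁⇓ (proj⇓ 0F) suc⇓) (triangle⇓ (suc s)))
                   (comp₁⇓ (proj⇓ 1F) suc⇓)
                   (monus⇓ (triangle (suc s)) (suc ⟨ x , y ⟩))

  positive : ∀ s → s < x + y →
             suc (pred (suc ⟨ x , y ⟩ ∸ triangle (suc s))) ≡ suc ⟨ x , y ⟩ ∸ triangle (suc s)
  positive s s<x+y = suc-pred _
    -- From `suc s ≤ x + y` follows `triangle (suc s) ≤ triangle (x + y) ≤ ⟨ x , y ⟩`, so the test
    -- fails at every earlier diagonal.
    {{>-nonZero (m<n⇒0<n∸m (s≤s (≤-trans (triangle-mono-≤ s<x+y) (m≤m+n _ y))))}}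

-- If `z` lies on diagonal `s`, its second component is `z ∸ triangle s`, and the first is `s` minus
-- that.
π₁ᶜ : Code 1
π₁ᶜ = comp monusᶜ (comp monusᶜ (comp triangleᶜ (diagonalᶜ ∷ []) ∷ proj 0F ∷ []) ∷ diagonalᶜ ∷ [])

π₁⇓ : ∀ {X} z → X ⊢ π₁ᶜ [ z ∷ [] ]⇓ π₁ z
π₁⇓ z with unpair z
... | x , y , refl = ⇓-resp
  (trans (cong (x + y ∸_) (m+n∸m≡n (triangle (x + y)) y)) (m+n∸n≡m x y))
  (comp₂⇓ (comp₂⇓ (comp₁⇓ (diagonal⇓ x y) (triangle⇓ (x + y))) (proj⇓ 0F)
                  (monus⇓ (triangle (x + y)) ⟨ x , y ⟩))
          (diagonal⇓ x y)
          (monus⇓ (⟨ x , y ⟩ ∸ triangle (x + y)) (x + y)))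

searchᶜ : Code 1
searchᶜ = mu (comp isZeroᶜ (comp oracle (queryᶜ ∷ []) ∷ []))
  where
  queryᶜ : Code 2
  queryᶜ = comp pairᶜ (comp pairᶜ (proj 0F ∷ comp π₁ᶜ (proj 0F ∷ []) ∷ []) ∷ proj 1F ∷ [])

-- Strong induction on the witness: either a bounded search below it finds a smaller one, or it is
-- the least itself.
least : ∀ {P : Pred ℕ 0ℓ} → Decidable P → ∃ P → ∃[ m ] P m × (∀ k → k < m → ¬ P k)
least {P} P? (n , Pn) = <-rec (λ n → P n → ∃[ m ] P m × (∀ k → k < m → ¬ P k)) step n Pn
  where
  step : ∀ n → (∀ {k} → k < n → P k → ∃[ m ] P m × (∀ k → k < m → ¬ P k)) →
         P n → ∃[ m ] P m × (∀ k → k < m → ¬ P k)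
  step n rec Pn with anyUpTo? P? n
  ... | yes (k , k<n , Pk) = rec k<n Pk
  ... | no  none           = n , Pn , λ k k<n Pk → none (k , k<n , Pk)

search⇓ : ∀ {X n} → Decidable X → (∃[ x ] X ⟨ ⟨ x , π₁ x ⟩ , n ⟩) →
          ∃[ x ] X ⊢ searchᶜ [ n ∷ [] ]⇓ x × X ⟨ ⟨ x , π₁ x ⟩ , n ⟩
search⇓ {X} {n} X? found with least (λ x → X? ⟨ ⟨ x , π₁ x ⟩ , n ⟩) found
... | x , hit , miss =
  x ,
  mu⇓ (comp₁⇓ (comp₁⇓ (query⇓ x) (yes⇓ hit)) isZero-1⇓)
      -- At an earlier candidate the oracle answers 0 and the inverted value is 1, that is `suc 0`.
      -- Minimality supplies the proof of non-membership that `no⇓` demands.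
      (λ z z<x → 0 , comp₁⇓ (comp₁⇓ (query⇓ z) (no⇓ (miss z z<x))) isZero-0⇓) ,
  hit
  where
  query⇓ : ∀ x → X ⊢ _ [ x ∷ n ∷ [] ]⇓ ⟨ ⟨ x , π₁ x ⟩ , n ⟩
  query⇓ x = comp₂⇓ (comp₂⇓ (proj⇓ 0F) (comp₁⇓ (proj⇓ 0F) (π₁⇓ x)) (pair⇓ x (π₁ x)))
                    (proj⇓ 1F) (pair⇓ ⟨ x , π₁ x ⟩ n)

-- Atomic equivalence of tuples

module _ {L : Language} where
  open Language L

  -- A common notion for identities, inclusions of substructures and isomorphisms, so that one
  -- induction on terms gives every atomic equivalence below.
  record Embedding (𝒜 ℬ : Structure L) : Set where
    private
      module A = Structure 𝒜
      module B = Structure ℬ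
    field
      to      : A.Carrier → B.Carrier
      ≈-emb   : ∀ x y → x A.≈ y ⇔ to x B.≈ to y
      rel-emb : ∀ R xs → A.rel R xs ⇔ B.rel R (to ∘ xs)
      fun-emb : ∀ F xs → to (A.fun F xs) B.≈ B.fun F (to ∘ xs)

  module _ (𝒜 : Structure L) where
    open Structure 𝒜 using () renaming (refl to ≈-refl)

    id-embedding : Embedding 𝒜 𝒜
    id-embedding = record
      { to      = id
      ; ≈-emb   = λ _ _ → ⇔-refl
      ; rel-emb = λ _ _ → ⇔-refl
      ; fun-emb = λ _ _ → ≈-refl
      }

    restrict-embedding : ∀ P sub → Embedding (restrict 𝒜 P sub) 𝒜
    restrict-embedding P sub = record
      { to      = proj₁
      ; ≈-emb   = λ _ _ → ⇔-refl
      ; rel-emb = λ _ _ → ⇔-refl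
      ; fun-emb = λ _ _ → ≈-refl
      }

  module _ {𝒜 ℬ : Structure L} where
    private
      module A = Structure 𝒜
      module B = Structure ℬ

    ≅⇒embedding : 𝒜 ≅ ℬ → Embedding 𝒜 ℬ
    ≅⇒embedding f = record
      { to      = to
      ; ≈-emb   = λ _ _ → mk⇔ to-cong injective
      ; rel-emb = _≅_.rel-iso f
      ; fun-emb = _≅_.fun-iso f
      }
      where
      open Injection (Inverse⇒Injection (_≅_.bijection f)) using (to; injective) renaming (cong to to-cong)

    module _ (h : Embedding 𝒜 ℬ) where
      open Embedding h

      -- The assignments match only up to `≈`. Applied to `id-embedding`, this also covers replacing
      -- an assignment by a pointwise equal one.
      eval-embedding : ∀ {n ρ σ} → (∀ k → to (ρ k) B.≈ σ k) →
                       ∀ (t : Term L n) → to (eval 𝒜 ρ t) B.≈ eval ℬ σ t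
      eval-embedding ρ≈σ (var k)    = ρ≈σ k
      eval-embedding ρ≈σ (app F ts) =
        B.trans (fun-emb F _) (B.fun-cong F λ k → eval-embedding ρ≈σ (ts k))

      ⊨-embedding : ∀ {n ρ σ} → (∀ k → to (ρ k) B.≈ σ k) →
                    ∀ (φ : Atomic L n) → _⊨_[_] 𝒜 φ ρ ⇔ _⊨_[_] ℬ φ σ
      ⊨-embedding {ρ = ρ} {σ} ρ≈σ (equal s t) =
        mk⇔ (λ p → B.trans (B.sym (eval≈ s)) (B.trans p (eval≈ t)))
            (λ p → B.trans (eval≈ s) (B.trans p (B.sym (eval≈ t))))
        ⇔∘ ≈-emb _ _
        where eval≈ = eval-embedding ρ≈σ
      ⊨-embedding ρ≈σ (relate R ts) =
        mk⇔ (B.rel-resp R λ k → eval≈ (ts k)) (B.rel-resp R λ k → B.sym (eval≈ (ts k)))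
        ⇔∘ rel-emb R _
        where eval≈ = eval-embedding ρ≈σ

      embedding⇒≃ : ∀ {a b} → Pointwise (λ x y → to x B.≈ y) a b → _≃_ {𝒜 = 𝒜} {ℬ} a b
      embedding⇒≃ a≈b = record
        { same-length = Pointwise-length a≈b
        ; same-atomic = ⊨-embedding (Pointwise.lookup⁺ a≈b)
        }

      map-embedding⇒≃ : ∀ {a b} → Pointwise B._≈_ (List.map to a) b → _≃_ {𝒜 = 𝒜} {ℬ} a b
      map-embedding⇒≃ {a} {b} ha≈b = embedding⇒≃ (Pointwise.map⁻ to id
        (subst (Pointwise B._≈_ (List.map to a)) (sym (map-id b)) ha≈b))

  Pointwise⇒≃ : (𝒜 : Structure L) → ∀ {a b} → Pointwise (Structure._≈_ 𝒜) a b →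
                _≃_ {𝒜 = 𝒜} {𝒜} a b
  Pointwise⇒≃ 𝒜 = embedding⇒≃ (id-embedding 𝒜)

  -- Moves a cast of variables from the assignment to the formula. Even along `refl` the cast is the
  -- identity only pointwise and propositionally, hence the detour through `id-embedding`.
  ⊨-cast : (𝒜 : Structure L) → ∀ {m n} (m≡n : m ≡ n) (φ : Atomic L m) ρ →
           _⊨_[_] 𝒜 φ (ρ ∘ cast m≡n) ⇔ _⊨_[_] 𝒜 (subst (Atomic L) m≡n φ) ρ
  ⊨-cast 𝒜 refl φ ρ =
    ⊨-embedding (id-embedding 𝒜) (λ k → Structure.reflexive 𝒜 (cong ρ (cast-is-id refl k))) φ

  module _ {𝒜 ℬ : Structure L} {a : Tuple 𝒜} {b : Tuple ℬ} where

    ≃-trans : ∀ {𝒞 : Structure L} {c : Tuple 𝒞} →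
              _≃_ {𝒜 = 𝒜} {ℬ} a b → _≃_ {𝒜 = ℬ} {𝒞} b c → _≃_ {𝒜 = 𝒜} {𝒞} a c
    ≃-trans {𝒞} {c} a≃b b≃c = record
      { same-length = trans AB.same-length BC.same-length
      -- The chain reads from its last line upwards. The formula has `length a` variables, so it is
      -- transported to `length b` before the second equivalence applies, then transported back;
      -- finally the two casts are fused.
      ; same-atomic = λ φ →
          ⊨-embedding (id-embedding 𝒞)
            (λ k → Structure.reflexive 𝒞
              (cong (List.lookup c) (cast-trans AB.same-length BC.same-length k))) φ
          ⇔∘ ⇔-sym (⊨-cast 𝒞 AB.same-length φ _)
          ⇔∘ BC.same-atomic (subst (Atomic L) AB.same-length φ)
          ⇔∘ ⊨-cast ℬ AB.same-length φ (List.lookup b)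
          ⇔∘ AB.same-atomic φ
      }
      where
      module AB = _≃_ a≃b
      module BC = _≃_ b≃c

  -- The substructure generated by a tuple

  module _ (𝒜 : Structure L) (b : Tuple 𝒜) where
    open Structure 𝒜 using () renaming (reflexive to ≈-reflexive)

    Cl-isSubstructure : IsSubstructure 𝒜 (Cl 𝒜 b)
    Cl-isSubstructure = record { resp = resp ; closed = closed }

    generatedBy : Structure L
    generatedBy = restrict 𝒜 (Cl 𝒜 b) Cl-isSubstructure

    generators : Tuple generatedBy
    generators = tabulate (λ k → List.lookup b k , generator k)

    map-generators : List.map proj₁ generators ≡ b
    map-generators = trans (map-tabulate _ proj₁) (tabulate-lookup b)

    -- Induction on the derivation that an element lies in the closure of `b`. Equality in the
    -- restriction ignores these derivations, and its functions build theirs with `closed`, so each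
    -- derivation step is copied inside the restriction.
    generators-generate : Generates generatedBy generators
    generators-generate (_ , x∈b) = go x∈b
      where
      go : ∀ {x} (x∈b : Cl 𝒜 b x) → Cl generatedBy generators (x , x∈b)
      -- Positions in `generators` are indexed by its own length rather than that of `b`, so the
      -- position is recovered from list membership.
      go (generator k)      = subst (Cl generatedBy generators) (sym (lookup-index k∈))
                                    (generator (index k∈))
        where k∈ = ∈-tabulate⁺ k
      go (closed F xs xs∈b) = closed F _ (λ k → go (xs∈b k))
      go (resp x≈y x∈b)     = resp x≈y (go x∈b)

    generators≃ : _≃_ {𝒜 = generatedBy} {𝒜} generators b
    generators≃ = map-embedding⇒≃ (restrict-embedding 𝒜 (Cl 𝒜 b) Cl-isSubstructure)
      (Pointwise.map ≈-reflexive (Pointwise.≡⇒Pointwise-≡ map-generators))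

-- Codes in a computable age and correctness of the search

module _ {L : Language} (ℳ : ωStructure L) where
  private
    M : Structure L
    M = ωStructure.structure ℳ

  -- A code records the underlying numbers but not the proofs that they lie in the domain, so the
  -- tuples agree only up to the equality of the structure.
  codeTuple-injective : ∀ {a b} → codeTuple ℳ a ≡ codeTuple ℳ b → Pointwise (Structure._≈_ M) a b
  codeTuple-injective {a} {b} eq =
    Pointwise.map⁻ proj₁ proj₁ (Pointwise.≡⇒Pointwise-≡ (⌜⌝-injective eq))

module _ {ℓ} {L : Language} {𝒦 : Pred (Structure L) ℓ} (𝕂 : ComputableAge 𝒦) where
  open ComputableAge 𝕂

  𝕀-injective : ∀ {i j} → 𝕀 i ≡ 𝕀 j → i ≡ j
  𝕀-injective {i} {j} eq =
    proj₂ (pair-injective {e i} {i} {e j} (proj₂ (pair-injective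
      {codeTuple (𝒜 i) (a i)} {⟨ e i , i ⟩} {codeTuple (𝒜 j) (a j)} eq)))

  π₁-𝕀 : ∀ i → π₁ (𝕀 i) ≡ codeTuple (𝒜 i) (a i)
  π₁-𝕀 i = π₁-pair (codeTuple (𝒜 i) (a i)) ⟨ e i , i ⟩

  represented-subtuple : HP 𝒦 → ∀ i (b : Tuple (A i)) → ∃[ j ] _≃_ {𝒜 = A j} {A i} (a j) b
  represented-subtuple hp i b with
    represents (generatedBy (A i) b) (hp (A i) (in-age i) _ (Cl-isSubstructure (A i) b))
               (generators (A i) b) (generators-generate (A i) b)
  ... | j , f , fa≈b = j , ≃-trans
    (map-embedding⇒≃ (≅⇒embedding f) fa≈b)
    (generators≃ (A i) b)

  -- Decoding yields `x ≡ 𝕀 k₀`, so `π₁ x` codes both `b₀` and `a k₀`. Likewise `b₁` and `b` have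
  -- the same code, and `b₀ ≃ b₁` transfers to `a k₀` and `b`.
  hit-sound : ∀ {x i} {b : Tuple (A i)} → EmbeddingInfo 𝕂 ⟨ ⟨ x , π₁ x ⟩ , codePointed i b ⟩ →
              ∃[ j ] x ≡ 𝕀 j × _≃_ {𝒜 = A j} {A i} (a j) b
  hit-sound {x} {i} {b} (k₀ , k₁ , b₀ , b₁ , eq , b₀≃b₁) with
    pair-injective {⟨ x , π₁ x ⟩} {_} {codePointed k₀ b₀} eq
  ... | eq₀ , eq₁ with pair-injective {x} {_} {𝕀 k₀} eq₀ | pair-injective {𝕀 i} {_} {𝕀 k₁} eq₁
  -- Identifying `k₁` with `i` puts `b₁` and `b` in the same structure, where their codes can be
  -- compared.
  ... | refl , π₁x≡b₀ | 𝕀i≡𝕀k₁ , b≡b₁ with refl ← 𝕀-injective {i} {k₁} 𝕀i≡𝕀k₁ =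
    k₀ , refl ,
    ≃-trans (Pointwise⇒≃ (A k₀) (codeTuple-injective (𝒜 k₀) (trans (sym (π₁-𝕀 k₀)) π₁x≡b₀)))
      (≃-trans b₀≃b₁ (Pointwise⇒≃ (A i) (codeTuple-injective (𝒜 i) (sym b≡b₁))))

lemma5p17 : ExcludedMiddle 0ℓ →
    ∀ {ℓ : Level} (L : Language) (𝒦 : Pred (Structure L) ℓ) →
    IsAge 𝒦 → (𝕂 : ComputableAge 𝒦) → HP 𝒦 →
    ComputableHP 𝕂 (EmbeddingInfo 𝕂)
lemma5p17 em L 𝒦 _ 𝕂 hp = searchᶜ , correct
  where
  open ComputableAge 𝕂

  correct : ∀ i (b : Tuple (A i)) → ∃[ j ]
    EmbeddingInfo 𝕂 ⊢ searchᶜ [ codePointed i b ∷ [] ]⇓ 𝕀 j × _≃_ {𝒜 = A j} {ℬ = A i} (a j) b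
  correct i b with represented-subtuple 𝕂 hp i b
  -- Excluded middle decides membership in the oracle set, which is what the existence of a least
  -- hit rests on.
  ... | j , aj≃b with search⇓ {EmbeddingInfo 𝕂} {codePointed i b} (λ _ → em)
    (𝕀 j , j , i , a j , b , cong (λ c → ⟨ ⟨ 𝕀 j , c ⟩ , codePointed i b ⟩) (π₁-𝕀 𝕂 j) , aj≃b)
  -- The least hit `x` may differ from `𝕀 j`; that it too has the required form is read off from the
  -- hit itself.
  ... | x , halts , hit with hit-sound 𝕂 {x} {i} {b} hit
  ... | k , refl , ak≃b = k , halts , ak≃b
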